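{- The following hold. (i) $AA^*-A^*A=2\mathbf{i}A^{\varepsilon}$; (ii) $A^*A^{\varepsilon}-A^{\varepsilon}A^*=2\mathbf{i}A$; (iii) $A^{\varepsilon}A-AA^{\varepsilon}=2\mathbf{i}A^*$.
   Context: Let $D$ be a positive integer and let $Q_D$ be the $D$-cube: the graph with vertex set $X=\{0,1\}^D$, two vertices being adjacent iff they differ in exactly one coordinate; $\partial$ denotes path-length distance. $\mathrm{Mat}_X(\mathbb{C})$ is the algebra of complex matrices with rows and columns indexed by $X$. Write $\mathbf{i}^2=-1$. Let $A$ be the adjacency matrix of $Q_D$. Fix $x=(0,0,\ldots,0)\in X$. Let $A^*$ be the diagonal matrix in $\mathrm{Mat}_X(\mathbb{C})$ with $(y,y)$-entry $D-2\partial(x,y)$ for $y\in X$ (the dual adjacency matrix). Let $A^{\varepsilon}=-\mathbf{i}(AA^*-A^*A)/2$ (the imaginary adjacency matrix). -}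

module Defs where

open import Algebra.Bundles using (CommutativeRing)
open import Data.Fin.Base using (Fin; zero; suc)
open import Data.Fin.Properties using (any?; all?)
import Data.Fin.Properties as Fin
open import Data.List.Base using (List; []; _∷_; map; foldr; allFin; cartesianProductWith)
open import Data.Nat.Base as ℕ using (ℕ; zero; suc; z≤n; s≤s)
import Data.Nat.Properties as ℕ
open import Data.Product using (Σ-syntax; ∃-syntax; ∃!; _×_; _,_; proj₁)
open import Data.Rational.Base using (ℚ; 0ℚ; 1ℚ; ½)
import Data.Rational.Properties as ℚ
open import Data.Rational.Solver using (module +-*-Solver)
open import Data.Sum.Base using (_⊎_; inj₁; inj₂)
open import Data.Vec.Base as Vec using (Vec; []; _∷_; lookup; replicate)
import Data.Vec.Properties as Vec
open import Function.Base using (_∘_)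
open import Level using (0ℓ)
open import Relation.Binary.PropositionalEquality
  using (_≡_; _≢_; refl; sym; trans; cong; subst)
open import Relation.Nullary
  using (Dec; yes; no; ¬_; ¬?; contradiction; _×-dec_; _→-dec_; map′)
open import Relation.Nullary.Decidable using (does)
open import Data.Bool.Base using (true; false; if_then_else_)

-- The reals are the Cauchy sequences of rationals, with equality the
-- setoid relation _≈ℝ_: the difference of the two sequences tends to 0.
-- Arithmetic is termwise.

module _ where
  open import Data.Rational.Base

  record ℝ : Set where
    constructor mkℝ
    field
      seq    : ℕ → ℚ
      cauchy : ∀ ε → .{{_ : Positive ε}} →
               ∃[ N ] (∀ m n → N ℕ.≤ m → N ℕ.≤ n → ∣ seq m - seq n ∣ < ε)
  open ℝ public

  infix 4 _≈ℝ_

  _≈ℝ_ : ℝ → ℝ → Set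
  x ≈ℝ y = ∀ ε → .{{_ : Positive ε}} →
           ∃[ N ] (∀ n → N ℕ.≤ n → ∣ seq x n - seq y n ∣ < ε)

  private
    positive½* : ∀ ε → .{{_ : Positive ε}} → Positive (½ * ε)
    positive½* ε = ℚ.pos*pos⇒pos ½ ε

    ½+½ : ∀ ε → ½ * ε + ½ * ε ≡ ε
    ½+½ ε = trans (sym (ℚ.*-distribʳ-+ ε ½ ½)) (ℚ.*-identityˡ ε)

    self-close : ∀ p ε → .{{_ : Positive ε}} → ∣ p - p ∣ < ε
    self-close p ε = subst (λ r → ∣ r ∣ < ε) (sym (ℚ.+-inverseʳ p)) (ℚ.positive⁻¹ ε)

    swap-close : ∀ p q → ∣ p - q ∣ ≡ ∣ q - p ∣
    swap-close p q = trans (cong ∣_∣ lem) (ℚ.∣-p∣≡∣p∣ (q - p))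
      where
      open +-*-Solver
      lem : p - q ≡ - (q - p)
      lem = solve 2 (λ a b → a :- b := :- (b :- a)) refl p q

    neg-close : ∀ p q → ∣ - p - - q ∣ ≡ ∣ p - q ∣
    neg-close p q = trans (cong ∣_∣ lem) (ℚ.∣-p∣≡∣p∣ (p - q))
      where
      open +-*-Solver
      lem : - p - - q ≡ - (p - q)
      lem = solve 2 (λ a b → (:- a) :- (:- b) := :- (a :- b)) refl p q

    sum-close : ∀ p q r s ε → ∣ p - r ∣ < ½ * ε → ∣ q - s ∣ < ½ * ε →
                ∣ (p + q) - (r + s) ∣ < ε
    sum-close p q r s ε h k = begin-strict
      ∣ (p + q) - (r + s) ∣  ≡⟨ cong ∣_∣ lem ⟩
      ∣ (p - r) + (q - s) ∣  ≤⟨ ℚ.∣p+q∣≤∣p∣+∣q∣ (p - r) (q - s) ⟩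
      ∣ p - r ∣ + ∣ q - s ∣  <⟨ ℚ.+-mono-< h k ⟩
      ½ * ε + ½ * ε          ≡⟨ ½+½ ε ⟩
      ε                      ∎
      where
      open ℚ.≤-Reasoning
      open +-*-Solver
      lem : (p + q) - (r + s) ≡ (p - r) + (q - s)
      lem = solve 4 (λ p q r s → (p :+ q) :- (r :+ s) := (p :- r) :+ (q :- s)) refl p q r s

    trans-close : ∀ p q r ε → ∣ p - q ∣ < ½ * ε → ∣ q - r ∣ < ½ * ε → ∣ p - r ∣ < ε
    trans-close p q r ε h k =
      subst (λ t → ∣ t ∣ < ε) lem (sum-close p q q r ε h k)
      where
      open +-*-Solver
      lem : (p + q) - (q + r) ≡ p - r
      lem = solve 3 (λ p q r → (p :+ q) :- (q :+ r) := p :- r) refl p q r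

    scaled-< : ∀ p B {q δ} → .{{_ : Positive B}} → ∣ p ∣ ≤ B → ∣ q ∣ < δ →
               ∣ p * q ∣ < B * δ
    scaled-< p B {q} {δ} h k = begin-strict
      ∣ p * q ∣      ≡⟨ ℚ.∣p*q∣≡∣p∣*∣q∣ p q ⟩
      ∣ p ∣ * ∣ q ∣  ≤⟨ ℚ.*-monoʳ-≤-nonNeg ∣ q ∣ {{ℚ.∣-∣-nonNeg q}} h ⟩
      B * ∣ q ∣      <⟨ ℚ.*-monoʳ-<-pos B k ⟩
      B * δ          ∎
      where open ℚ.≤-Reasoning

    prod-close : ∀ p q r s B C δ → .{{_ : Positive B}} → .{{_ : Positive C}} →
                 ∣ p ∣ ≤ B → ∣ s ∣ ≤ C → ∣ p - r ∣ < δ → ∣ q - s ∣ < δ →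
                 ∣ p * q - r * s ∣ < (B + C) * δ
    prod-close p q r s B C δ hB hC h k = begin-strict
      ∣ p * q - r * s ∣                  ≡⟨ cong ∣_∣ lem ⟩
      ∣ p * (q - s) + s * (p - r) ∣      ≤⟨ ℚ.∣p+q∣≤∣p∣+∣q∣ (p * (q - s)) (s * (p - r)) ⟩
      ∣ p * (q - s) ∣ + ∣ s * (p - r) ∣  <⟨ ℚ.+-mono-< (scaled-< p B hB k) (scaled-< s C hC h) ⟩
      B * δ + C * δ                      ≡⟨ ℚ.*-distribʳ-+ δ B C ⟨
      (B + C) * δ                        ∎
      where
      open ℚ.≤-Reasoning
      open +-*-Solver
      lem : p * q - r * s ≡ p * (q - s) + s * (p - r)
      lem = solve 4 (λ p q r s → p :* q :- r :* s := p :* (q :- s) :+ s :* (p :- r)) refl p q r s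

    EventualBound : ℝ → Set
    EventualBound x = Σ[ B ∈ ℚ ] Positive B × ∃[ N ] (∀ n → N ℕ.≤ n → ∣ seq x n ∣ ≤ B)

    bound : ∀ x → EventualBound x
    bound x =
      let N , c = cauchy x 1ℚ
      in ∣ seq x N ∣ + 1ℚ
       , ℚ.nonNeg+pos⇒pos ∣ seq x N ∣ {{ℚ.∣-∣-nonNeg (seq x N)}} 1ℚ
       , N , λ n N≤n → stays-near (seq x N) (seq x n) (c n N N≤n ℕ.≤-refl)
      where
      stays-near : ∀ p q → ∣ q - p ∣ < 1ℚ → ∣ q ∣ ≤ ∣ p ∣ + 1ℚ
      stays-near p q h = begin
        ∣ q ∣              ≡⟨ cong ∣_∣ lem ⟩
        ∣ p + (q - p) ∣    ≤⟨ ℚ.∣p+q∣≤∣p∣+∣q∣ p (q - p) ⟩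
        ∣ p ∣ + ∣ q - p ∣  ≤⟨ ℚ.+-monoʳ-≤ ∣ p ∣ (ℚ.<⇒≤ h) ⟩
        ∣ p ∣ + 1ℚ         ∎
        where
        open ℚ.≤-Reasoning
        open +-*-Solver
        lem : q ≡ p + (q - p)
        lem = solve 2 (λ p q → q := p :+ (q :- p)) refl p q

    tolerance : ∀ B C ε → .{{_ : Positive B}} → .{{_ : Positive C}} → .{{_ : Positive ε}} →
                ∃[ δ ] (Positive δ × (B + C) * δ ≡ ε)
    tolerance B C ε = inv * ε , ℚ.pos*pos⇒pos inv {{ℚ.1/pos⇒pos (B + C) {{ps}}}} ε
      , trans (sym (ℚ.*-assoc (B + C) inv ε))
       (trans (cong (_* ε) (ℚ.*-inverseʳ (B + C) {{nz}})) (ℚ.*-identityˡ ε))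
      where
      ps : Positive (B + C)
      ps = ℚ.pos+pos⇒pos B C
      nz : NonZero (B + C)
      nz = ℚ.pos⇒nonZero (B + C) {{ps}}
      inv : ℚ
      inv = (1/ (B + C)) {{nz}}

    ⊔₁ : ∀ {a b n} → a ℕ.⊔ b ℕ.≤ n → a ℕ.≤ n
    ⊔₁ {a} {b} = ℕ.m⊔n≤o⇒m≤o a b

    ⊔₂ : ∀ {a b n} → a ℕ.⊔ b ℕ.≤ n → b ℕ.≤ n
    ⊔₂ {a} {b} = ℕ.m⊔n≤o⇒n≤o a b

  constℝ : ℚ → ℝ
  constℝ q = mkℝ (λ _ → q) (λ ε → 0 , λ _ _ _ _ → self-close q ε)

  infixl 6 _+ℝ_ _-ℝ_
  infixl 7 _*ℝ_
  infix  8 -ℝ_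

  _+ℝ_ : ℝ → ℝ → ℝ
  seq    (x +ℝ y) n = seq x n + seq y n
  cauchy (x +ℝ y) ε =
    let N , c = cauchy x (½ * ε) {{positive½* ε}}
        M , d = cauchy y (½ * ε) {{positive½* ε}}
    in N ℕ.⊔ M , λ m n hm hn →
      sum-close (seq x m) (seq y m) (seq x n) (seq y n) ε
        (c m n (⊔₁ hm) (⊔₁ hn)) (d m n (⊔₂ {N} hm) (⊔₂ {N} hn))

  -ℝ_ : ℝ → ℝ
  seq    (-ℝ x) n = - seq x n
  cauchy (-ℝ x) ε =
    let N , c = cauchy x ε
    in N , λ m n hm hn →
      subst (_< ε) (sym (neg-close (seq x m) (seq x n))) (c m n hm hn)

  _-ℝ_ : ℝ → ℝ → ℝ
  x -ℝ y = x +ℝ (-ℝ y)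

  _*ℝ_ : ℝ → ℝ → ℝ
  seq    (x *ℝ y) n = seq x n * seq y n
  cauchy (x *ℝ y) ε =
    let B , B>0 , K , hB = bound x
        C , C>0 , L , hC = bound y
        δ , δ>0 , eq     = tolerance B C ε {{B>0}} {{C>0}}
        N , c = cauchy x δ {{δ>0}}
        M , d = cauchy y δ {{δ>0}}
    in (K ℕ.⊔ L) ℕ.⊔ (N ℕ.⊔ M) , λ m n hm hn →
      subst (∣ seq x m * seq y m - seq x n * seq y n ∣ <_) eq
        (prod-close (seq x m) (seq y m) (seq x n) (seq y n) B C δ {{B>0}} {{C>0}}
          (hB m (⊔₁ (⊔₁ hm))) (hC n (⊔₂ {K} (⊔₁ hn)))
          (c m n (⊔₁ (⊔₂ {K ℕ.⊔ L} hm)) (⊔₁ (⊔₂ {K ℕ.⊔ L} hn)))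
          (d m n (⊔₂ {N} (⊔₂ {K ℕ.⊔ L} hm)) (⊔₂ {N} (⊔₂ {K ℕ.⊔ L} hn))))

  pointwise⇒≈ℝ : ∀ {x y} → (∀ n → seq x n ≡ seq y n) → x ≈ℝ y
  pointwise⇒≈ℝ {x} {y} h ε =
    0 , λ n _ → subst (λ q → ∣ seq x n - q ∣ < ε) (h n) (self-close (seq x n) ε)

  ≈ℝ-sym : ∀ {x y} → x ≈ℝ y → y ≈ℝ x
  ≈ℝ-sym {x} {y} h ε =
    let N , c = h ε
    in N , λ n hn → subst (_< ε) (swap-close (seq x n) (seq y n)) (c n hn)

  ≈ℝ-trans : ∀ {x y z} → x ≈ℝ y → y ≈ℝ z → x ≈ℝ z
  ≈ℝ-trans {x} {y} {z} h k ε =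
    let N , c = h (½ * ε) {{positive½* ε}}
        M , d = k (½ * ε) {{positive½* ε}}
    in N ℕ.⊔ M , λ n hn →
      trans-close (seq x n) (seq y n) (seq z n) ε (c n (⊔₁ hn)) (d n (⊔₂ {N} hn))

  +ℝ-cong : ∀ {x x′ y y′} → x ≈ℝ x′ → y ≈ℝ y′ → x +ℝ y ≈ℝ x′ +ℝ y′
  +ℝ-cong {x} {x′} {y} {y′} h k ε =
    let N , c = h (½ * ε) {{positive½* ε}}
        M , d = k (½ * ε) {{positive½* ε}}
    in N ℕ.⊔ M , λ n hn →
      sum-close (seq x n) (seq y n) (seq x′ n) (seq y′ n) ε (c n (⊔₁ hn)) (d n (⊔₂ {N} hn))

  -ℝ-cong : ∀ {x x′} → x ≈ℝ x′ → -ℝ x ≈ℝ -ℝ x′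
  -ℝ-cong {x} {x′} h ε =
    let N , c = h ε
    in N , λ n hn → subst (_< ε) (sym (neg-close (seq x n) (seq x′ n))) (c n hn)

  *ℝ-cong : ∀ {x x′ y y′} → x ≈ℝ x′ → y ≈ℝ y′ → x *ℝ y ≈ℝ x′ *ℝ y′
  *ℝ-cong {x} {x′} {y} {y′} h k ε =
    let B , B>0 , K , hB = bound x
        C , C>0 , L , hC = bound y′
        δ , δ>0 , eq     = tolerance B C ε {{B>0}} {{C>0}}
        N , c = h δ {{δ>0}}
        M , d = k δ {{δ>0}}
    in (K ℕ.⊔ L) ℕ.⊔ (N ℕ.⊔ M) , λ n hn →
      subst (∣ seq x n * seq y n - seq x′ n * seq y′ n ∣ <_) eq
        (prod-close (seq x n) (seq y n) (seq x′ n) (seq y′ n) B C δ {{B>0}} {{C>0}}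
          (hB n (⊔₁ (⊔₁ hn))) (hC n (⊔₂ {K} (⊔₁ hn)))
          (c n (⊔₁ (⊔₂ {K ℕ.⊔ L} hn)))
          (d n (⊔₂ {N} (⊔₂ {K ℕ.⊔ L} hn))))

-- a +i b stands for a + 𝐢b.

record Complex : Set where
  constructor _+i_
  field
    re im : ℝ
open Complex public

infix 4 _≈ᶜ_

record _≈ᶜ_ (z w : Complex) : Set where
  constructor _,_
  field
    re≈ : re z ≈ℝ re w
    im≈ : im z ≈ℝ im w

fromℚ : ℚ → Complex
fromℚ q = constℝ q +i constℝ 0ℚ

𝐢 : Complex
𝐢 = constℝ 0ℚ +i constℝ 1ℚ

infixl 6 _+ᶜ_
infixl 7 _*ᶜ_
infix  8 -ᶜ_

_+ᶜ_ : Complex → Complex → Complex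
(a +i b) +ᶜ (c +i d) = (a +ℝ c) +i (b +ℝ d)

-ᶜ_ : Complex → Complex
-ᶜ (a +i b) = (-ℝ a) +i (-ℝ b)

_*ᶜ_ : Complex → Complex → Complex
(a +i b) *ᶜ (c +i d) = (a *ℝ c -ℝ b *ℝ d) +i (a *ℝ d +ℝ b *ℝ c)

private
  pointwise⇒≈ᶜ : ∀ {z w} → (∀ n → seq (re z) n ≡ seq (re w) n) →
                 (∀ n → seq (im z) n ≡ seq (im w) n) → z ≈ᶜ w
  pointwise⇒≈ᶜ {z} {w} h k =
    pointwise⇒≈ℝ {re z} {re w} h , pointwise⇒≈ℝ {im z} {im w} k

  +ᶜ-cong : ∀ {z z′ w w′} → z ≈ᶜ z′ → w ≈ᶜ w′ → z +ᶜ w ≈ᶜ z′ +ᶜ w′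
  +ᶜ-cong {a +i b} {a′ +i b′} {c +i d} {c′ +i d′} (p , q) (r , s) =
    +ℝ-cong {a} {a′} {c} {c′} p r , +ℝ-cong {b} {b′} {d} {d′} q s

  *ᶜ-cong : ∀ {z z′ w w′} → z ≈ᶜ z′ → w ≈ᶜ w′ → z *ᶜ w ≈ᶜ z′ *ᶜ w′
  *ᶜ-cong {a +i b} {a′ +i b′} {c +i d} {c′ +i d′} (p , q) (r , s) =
      +ℝ-cong {a *ℝ c} {a′ *ℝ c′} { -ℝ (b *ℝ d)} { -ℝ (b′ *ℝ d′)}
        (*ℝ-cong {a} {a′} {c} {c′} p r)
        (-ℝ-cong {b *ℝ d} {b′ *ℝ d′} (*ℝ-cong {b} {b′} {d} {d′} q s))
    , +ℝ-cong {a *ℝ d} {a′ *ℝ d′} {b *ℝ c} {b′ *ℝ c′}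
        (*ℝ-cong {a} {a′} {d} {d′} p s) (*ℝ-cong {b} {b′} {c} {c′} q r)

module _ where
  open +-*-Solver
  open import Algebra.Structures _≈ᶜ_ using (IsCommutativeRing)

  private
    mul-re mul-im : ∀ {n} → (a b c d : Polynomial n) → Polynomial n
    mul-re a b c d = a :* c :- b :* d
    mul-im a b c d = a :* d :+ b :* c

    *-re-assoc : ∀ a b c d e f → _
    *-re-assoc = solve 6 (λ a b c d e f →
      mul-re (mul-re a b c d) (mul-im a b c d) e f :=
      mul-re a b (mul-re c d e f) (mul-im c d e f)) refl

    *-im-assoc : ∀ a b c d e f → _
    *-im-assoc = solve 6 (λ a b c d e f →
      mul-im (mul-re a b c d) (mul-im a b c d) e f :=
      mul-im a b (mul-re c d e f) (mul-im c d e f)) refl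

    *-re-comm : ∀ a b c d → _
    *-re-comm = solve 4 (λ a b c d → mul-re a b c d := mul-re c d a b) refl

    *-im-comm : ∀ a b c d → _
    *-im-comm = solve 4 (λ a b c d → mul-im a b c d := mul-im c d a b) refl

    *-re-identityˡ : ∀ a b → _
    *-re-identityˡ = solve 2 (λ a b → mul-re (con 1ℚ) (con 0ℚ) a b := a) refl

    *-im-identityˡ : ∀ a b → _
    *-im-identityˡ = solve 2 (λ a b → mul-im (con 1ℚ) (con 0ℚ) a b := b) refl

    *-re-identityʳ : ∀ a b → _
    *-re-identityʳ = solve 2 (λ a b → mul-re a b (con 1ℚ) (con 0ℚ) := a) refl

    *-im-identityʳ : ∀ a b → _
    *-im-identityʳ = solve 2 (λ a b → mul-im a b (con 1ℚ) (con 0ℚ) := b) refl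

    re-distribˡ : ∀ a b c d e f → _
    re-distribˡ = solve 6 (λ a b c d e f →
      mul-re a b (c :+ e) (d :+ f) := mul-re a b c d :+ mul-re a b e f) refl

    im-distribˡ : ∀ a b c d e f → _
    im-distribˡ = solve 6 (λ a b c d e f →
      mul-im a b (c :+ e) (d :+ f) := mul-im a b c d :+ mul-im a b e f) refl

    re-distribʳ : ∀ a b c d e f → _
    re-distribʳ = solve 6 (λ a b c d e f →
      mul-re (c :+ e) (d :+ f) a b := mul-re c d a b :+ mul-re e f a b) refl

    im-distribʳ : ∀ a b c d e f → _
    im-distribʳ = solve 6 (λ a b c d e f →
      mul-im (c :+ e) (d :+ f) a b := mul-im c d a b :+ mul-im e f a b) refl

    at₂ : ∀ {ℓ} {P : ℚ → ℚ → Set ℓ} → (∀ a b → P a b) →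
          (z : Complex) → ∀ n → P (seq (re z) n) (seq (im z) n)
    at₂ h z n = h _ _

    at₄ : ∀ {ℓ} {P : ℚ → ℚ → ℚ → ℚ → Set ℓ} → (∀ a b c d → P a b c d) →
          (z w : Complex) → ∀ n →
          P (seq (re z) n) (seq (im z) n) (seq (re w) n) (seq (im w) n)
    at₄ h z w n = h _ _ _ _

    at₆ : ∀ {ℓ} {P : ℚ → ℚ → ℚ → ℚ → ℚ → ℚ → Set ℓ} → (∀ a b c d e f → P a b c d e f) →
          (z w v : Complex) → ∀ n →
          P (seq (re z) n) (seq (im z) n) (seq (re w) n) (seq (im w) n) (seq (re v) n) (seq (im v) n)
    at₆ h z w v n = h _ _ _ _ _ _

  +ᶜ-*ᶜ-isCommutativeRing : IsCommutativeRing _+ᶜ_ _*ᶜ_ -ᶜ_ (fromℚ 0ℚ) (fromℚ 1ℚ)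
  +ᶜ-*ᶜ-isCommutativeRing = record
    { isRing = record
      { +-isAbelianGroup = record
        { isGroup = record
          { isMonoid = record
            { isSemigroup = record
              { isMagma = record
                { isEquivalence = record
                  { refl  = pointwise⇒≈ᶜ (λ _ → refl) (λ _ → refl)
                  ; sym   = λ { {a +i b} {c +i d} (p , q) →
                              ≈ℝ-sym {a} {c} p , ≈ℝ-sym {b} {d} q }
                  ; trans = λ { {a +i b} {c +i d} {e +i f} (p , q) (r , s) →
                              ≈ℝ-trans {a} {c} {e} p r , ≈ℝ-trans {b} {d} {f} q s }
                  }
                ; ∙-cong = +ᶜ-cong
                }
              ; assoc = λ z w v → pointwise⇒≈ᶜ
                  (λ n → ℚ.+-assoc (seq (re z) n) (seq (re w) n) (seq (re v) n))
                  (λ n → ℚ.+-assoc (seq (im z) n) (seq (im w) n) (seq (im v) n))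
              }
            ; identity = (λ z → pointwise⇒≈ᶜ (λ n → ℚ.+-identityˡ (seq (re z) n))
                                              (λ n → ℚ.+-identityˡ (seq (im z) n)))
                       , (λ z → pointwise⇒≈ᶜ (λ n → ℚ.+-identityʳ (seq (re z) n))
                                              (λ n → ℚ.+-identityʳ (seq (im z) n)))
            }
          ; inverse = (λ z → pointwise⇒≈ᶜ (λ n → ℚ.+-inverseˡ (seq (re z) n))
                                          (λ n → ℚ.+-inverseˡ (seq (im z) n)))
                    , (λ z → pointwise⇒≈ᶜ (λ n → ℚ.+-inverseʳ (seq (re z) n))
                                          (λ n → ℚ.+-inverseʳ (seq (im z) n)))
          ; ⁻¹-cong = λ { {a +i b} {c +i d} (p , q) → -ℝ-cong {a} {c} p , -ℝ-cong {b} {d} q }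
          }
        ; comm = λ z w → pointwise⇒≈ᶜ (λ n → ℚ.+-comm (seq (re z) n) (seq (re w) n))
                                      (λ n → ℚ.+-comm (seq (im z) n) (seq (im w) n))
        }
      ; *-cong = *ᶜ-cong
      ; *-assoc = λ z w v → pointwise⇒≈ᶜ (at₆ *-re-assoc z w v) (at₆ *-im-assoc z w v)
      ; *-identity = (λ z → pointwise⇒≈ᶜ (at₂ *-re-identityˡ z) (at₂ *-im-identityˡ z))
                   , (λ z → pointwise⇒≈ᶜ (at₂ *-re-identityʳ z) (at₂ *-im-identityʳ z))
      ; distrib = (λ z w v → pointwise⇒≈ᶜ (at₆ re-distribˡ z w v) (at₆ im-distribˡ z w v))
                , (λ z w v → pointwise⇒≈ᶜ (at₆ re-distribʳ z w v) (at₆ im-distribʳ z w v))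
      }
    ; *-comm = λ z w → pointwise⇒≈ᶜ (at₄ *-re-comm z w) (at₄ *-im-comm z w)
    }

ℂ : CommutativeRing 0ℓ 0ℓ
ℂ = record { isCommutativeRing = +ᶜ-*ᶜ-isCommutativeRing }

𝐢*𝐢≈-1 : 𝐢 *ᶜ 𝐢 ≈ᶜ -ᶜ fromℚ 1ℚ
𝐢*𝐢≈-1 = pointwise⇒≈ᶜ (λ _ → refl) (λ _ → refl)

X : ℕ → Set
X D = Vec (Fin 2) D

infix 4 _≟_

_≟_ : ∀ {D} (x y : X D) → Dec (x ≡ y)
_≟_ = Vec.≡-dec Fin._≟_

origin : ∀ D → X D
origin D = replicate D zero

vertices : ∀ D → List (X D)
vertices zero    = [] ∷ []
vertices (suc D) = cartesianProductWith _∷_ (allFin 2) (vertices D)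

Adjacent : ∀ {D} → X D → X D → Set
Adjacent x y = ∃! _≡_ (λ i → lookup x i ≢ lookup y i)

adjacent? : ∀ {D} (x y : X D) → Dec (Adjacent x y)
adjacent? x y =
  map′ (λ (i , d , u) → i , d , λ {j} → u j) (λ (i , d , u) → i , d , λ j → u {j})
    (any? λ i → differ? i ×-dec all? λ j → differ? j →-dec (i Fin.≟ j))
  where
  differ? : ∀ i → Dec (lookup x i ≢ lookup y i)
  differ? i = ¬? (lookup x i Fin.≟ lookup y i)

data Walk {D} : X D → X D → ℕ → Set where
  []  : ∀ {x} → Walk x x 0
  _∷_ : ∀ {x y z n} → Adjacent x y → Walk y z n → Walk x z (suc n)

IsShortestWalkLength : ∀ {D} → X D → X D → ℕ → Set
IsShortestWalkLength x y n = Walk x y n × (∀ {m} → Walk x y m → n ℕ.≤ m)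

-- Hamming distance is used only to exhibit a shortest walk; ∂ is
-- specified by IsShortestWalkLength.

weight : Fin 2 → Fin 2 → ℕ
weight a b = if does (a Fin.≟ b) then 0 else 1

hamming : ∀ {D} → X D → X D → ℕ
hamming []      []      = 0
hamming (a ∷ x) (b ∷ y) = weight a b ℕ.+ hamming x y

hamming-refl : ∀ {D} (x : X D) → hamming x x ≡ 0
hamming-refl []            = refl
hamming-refl (zero     ∷ x) = hamming-refl x
hamming-refl (suc zero ∷ x) = hamming-refl x

weight-step : ∀ a b c → weight a c ℕ.≤ suc (weight b c)
weight-step a b c with does (a Fin.≟ c)
... | true  = z≤n
... | false = s≤s z≤n

agree : ∀ {D} {x y : X D} → (∀ i → ¬ (lookup x i ≢ lookup y i)) → x ≡ y
agree {x = []}    {[]}    h = refl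
agree {x = a ∷ x} {b ∷ y} h with a Fin.≟ b
... | yes refl = cong (a ∷_) (agree (h ∘ suc))
... | no  a≢b  = contradiction a≢b (h zero)

split : ∀ {D a b} {x y : X D} → Adjacent (a ∷ x) (b ∷ y) →
        x ≡ y ⊎ (a ≡ b × Adjacent x y)
split (zero , d , u) = inj₁ (agree λ j e → contradiction (u {suc j} e) λ ())
split {a = a} {b} (suc i , d , u) with a Fin.≟ b
... | yes a≡b = inj₂ (a≡b , i , d , λ e → Fin.suc-injective (u e))
... | no  a≢b = contradiction (u {zero} a≢b) λ ()

hamming-step : ∀ {D} (x y z : X D) → Adjacent x y → hamming x z ℕ.≤ suc (hamming y z)
hamming-step []      []      []      (() , _)
hamming-step (a ∷ x) (b ∷ y) (c ∷ z) e with split e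
... | inj₁ refl       = ℕ.+-monoˡ-≤ (hamming x z) (weight-step a b c)
... | inj₂ (refl , f) =
  ℕ.≤-trans (ℕ.+-monoʳ-≤ (weight a c) (hamming-step x y z f))
            (ℕ.≤-reflexive (ℕ.+-suc (weight a c) (hamming y z)))

hamming-≤ : ∀ {D} {x y : X D} {m} → Walk x y m → hamming x y ℕ.≤ m
hamming-≤ {x = x} []  = ℕ.≤-reflexive (hamming-refl x)
hamming-≤ {x = x} {z} (_∷_ {y = y} e w) =
  ℕ.≤-trans (hamming-step x y z e) (s≤s (hamming-≤ w))

extend : ∀ {D} a {x y : X D} {n} → Walk x y n → Walk (a ∷ x) (a ∷ y) n
extend a []                = []
extend a ((i , d , u) ∷ w) = (suc i , d , unique) ∷ extend a w
  where
  unique : ∀ {j} → _ → suc i ≡ j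
  unique {zero}  e = contradiction refl e
  unique {suc j} e = cong suc (u e)

flip : ∀ {D} {a b} (x : X D) → a ≢ b → Adjacent (a ∷ x) (b ∷ x)
flip x a≢b = zero , a≢b , λ { {zero} _ → refl ; {suc j} e → contradiction refl e }

hamming-walk : ∀ {D} (x y : X D) → Walk x y (hamming x y)
hamming-walk []      []      = []
hamming-walk (a ∷ x) (b ∷ y) with a Fin.≟ b
... | yes refl = extend a (hamming-walk x y)
... | no  a≢b  = flip x a≢b ∷ extend b (hamming-walk x y)

shortestWalk : ∀ {D} (x y : X D) → ∃[ n ] IsShortestWalkLength x y n
shortestWalk x y = hamming x y , hamming-walk x y , hamming-≤

∂ : ∀ {D} → X D → X D → ℕ
∂ x y = proj₁ (shortestWalk x y)

module CubeMatrices {c ℓ} (R : CommutativeRing c ℓ) where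
  open CommutativeRing R
  open import Algebra.Properties.Semiring.Mult semiring using () renaming (_×_ to _×ᴿ_)

  Mat : ℕ → Set c
  Mat D = X D → X D → Carrier

  infix  4 _≋_
  infixl 6 _⊖_
  infixl 7 _⊗_
  infixr 8 _•_

  _≋_ : ∀ {D} → Mat D → Mat D → Set ℓ
  M ≋ N = ∀ y z → M y z ≈ N y z

  _⊖_ : ∀ {D} → Mat D → Mat D → Mat D
  (M ⊖ N) y z = M y z - N y z

  _•_ : ∀ {D} → Carrier → Mat D → Mat D
  (k • M) y z = k * M y z

  ∑ : ∀ {D} → (X D → Carrier) → Carrier
  ∑ {D} f = foldr _+_ 0# (map f (vertices D))

  _⊗_ : ∀ {D} → Mat D → Mat D → Mat D
  (M ⊗ N) y z = ∑ λ w → M y w * N w z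

  fromℕ : ℕ → Carrier
  fromℕ n = n ×ᴿ 1#

  adjacencyMatrix : ∀ D → Mat D
  adjacencyMatrix D y z = if does (adjacent? y z) then 1# else 0#

  -- D − 2∂(x,y) may be negative, so the subtraction is done in R, not ℕ.

  dualAdjacencyMatrix : ∀ D → Mat D
  dualAdjacencyMatrix D y z =
    if does (y ≟ z) then fromℕ D - fromℕ (2 ℕ.* ∂ (origin D) y) else 0#

open CubeMatrices ℂ public

A : ∀ D → Mat D
A = adjacencyMatrix

A* : ∀ D → Mat D
A* = dualAdjacencyMatrix

Aᵋ : ∀ D → Mat D
Aᵋ D = (-ᶜ 𝐢 *ᶜ fromℚ ½) • (A D ⊗ A* D ⊖ A* D ⊗ A D)

2𝐢 : Complex
2𝐢 = fromℕ 2 *ᶜ 𝐢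

{-# OPTIONS --safe #-}
module Submission where

-- Let θ y be the (y, y)-entry of A*, so that (AA* − A*A)(y, z) = A(y, z)(θ z − θ y). Relation (i)
-- is immediate. Adjacent vertices have θ-values differing by ±2, so (ii) says A(y, z)(θ y − θ z)² =
-- 4 A(y, z), and (iii) says Σ_w A(y, w) A(w, z) (2 θ w − θ y − θ z) = −4 I(y, z) θ y. Both follow by
-- induction on D over any commutative ring, splitting off the first coordinate:
-- θ(a ∷ y) = ±1 + θ y, A(a ∷ y, a ∷ z) = A(y, z), and A(a ∷ y, b ∷ z) = I(y, z) for a ≠ b.

open import Algebra.Bundles using (CommutativeRing)
open import Data.Bool.Base using (true; false; if_then_else_)
open import Data.Fin.Base using (Fin; zero; suc; opposite)
open import Data.Integer.Base as ℤ using (ℤ; +_; -[1+_]; 0ℤ; 1ℤ)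
import Data.Integer.Properties as ℤ
open import Data.List.Base using ([]; _∷_; _++_; map; foldr)
import Data.List.Properties as List
open import Data.Maybe.Base as Maybe using (Maybe)
open import Data.Nat.Base using (ℕ; NonZero; zero; suc)
import Data.Nat.Base as ℕ
import Data.Nat.Properties as ℕ
open import Data.Product.Base using (_×_; _,_)
open import Data.Rational.Base using (½; 0ℚ; 1ℚ; _/_)
open import Data.Sum.Base using (inj₁; inj₂)
open import Data.Vec.Base using ([]; _∷_)
open import Function.Base using (_∘_)
open import Function.Bundles using (mk⇔)
open import Relation.Binary.PropositionalEquality as ≡ using (_≡_; _≢_; refl; cong; cong₂)
open import Relation.Nullary using (yes; no; contradiction)
open import Relation.Nullary.Decidable using (does; dec⇒maybe; does-⇔)

open import Defs using
  (X; origin; vertices; _≟_; ∂; Adjacent; adjacent?; split; flip; module CubeMatrices)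

-- Equality of ring elements is undecidable in general; with ℤ as the coefficient ring the solver
-- can still cancel terms.
module IntegerCoefficients {c ℓ} (R : CommutativeRing c ℓ) where
  open CommutativeRing R hiding (refl; zero)
  private module R = CommutativeRing R
  open import Algebra.Properties.Ring ring
  open import Algebra.Properties.Semiring.Mult.TCOptimised semiring using (×-homo-+; ×1-homo-*)
    renaming (_×_ to _×ᴿ_)
  open import Algebra.Solver.Ring.AlmostCommutativeRing
    using (_-Raw-AlmostCommutative⟶_; fromCommutativeRing)
  open import Relation.Binary.Reasoning.Setoid setoid

  -- With the optimised multiple `_×ᴿ_`, `fromℤ 1ℤ` computes to `1#` with no trailing `0#`, so
  -- `con 1ℤ` and `con 0ℤ` denote exactly `1#` and `0#`.
  fromℤ : ℤ → Carrier
  fromℤ (+ n)    = n ×ᴿ 1#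
  fromℤ -[1+ n ] = - (suc n ×ᴿ 1#)

  -- The homomorphism from the integers.

  fromℤ-⊖ : ∀ m n → fromℤ (m ℤ.⊖ n) ≈ m ×ᴿ 1# - n ×ᴿ 1#
  fromℤ-⊖ m zero = begin
    m ×ᴿ 1#         ≈⟨ +-identityʳ _ ⟨
    m ×ᴿ 1# + 0#    ≈⟨ +-congˡ -0#≈0# ⟨
    m ×ᴿ 1# - 0#    ∎
  fromℤ-⊖ zero (suc n) = sym (+-identityˡ _)
  fromℤ-⊖ (suc m) (suc n) = begin
    fromℤ (suc m ℤ.⊖ suc n)              ≡⟨ cong fromℤ (ℤ.[1+m]⊖[1+n]≡m⊖n m n) ⟩
    fromℤ (m ℤ.⊖ n)                      ≈⟨ fromℤ-⊖ m n ⟩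
    m′ - n′                              ≈⟨ +-congˡ (+-identityˡ _) ⟨
    -- Inserting `1# - 1#` supplies the extra unit of both `suc m` and `suc n`.
    m′ + (0# - n′)                       ≈⟨ +-congˡ (+-congʳ (-‿inverseʳ 1#)) ⟨
    m′ + ((1# - 1#) - n′)                ≈⟨ +-congˡ (+-assoc _ _ _) ⟩
    m′ + (1# + (- 1# - n′))              ≈⟨ +-assoc _ _ _ ⟨
    (m′ + 1#) + (- 1# - n′)              ≈⟨ +-cong (+-comm _ _) (-‿+-comm _ _) ⟩
    (1# + m′) - (1# + n′)                ≈⟨ +-cong (×-homo-+ 1# 1 m) (-‿cong (×-homo-+ 1# 1 n)) ⟨
    suc m ×ᴿ 1# - suc n ×ᴿ 1#            ∎
    where
    m′ = m ×ᴿ 1#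
    n′ = n ×ᴿ 1#

  fromℤ-neg : ∀ i → fromℤ (ℤ.- i) ≈ - fromℤ i
  fromℤ-neg (+ zero)  = sym -0#≈0#
  fromℤ-neg (+ suc n) = R.refl
  fromℤ-neg -[1+ n ]  = sym (-‿involutive _)

  fromℤ-+ : ∀ i j → fromℤ (i ℤ.+ j) ≈ fromℤ i + fromℤ j
  fromℤ-+ (+ m)    (+ n)    = ×-homo-+ 1# m n
  fromℤ-+ (+ m)    -[1+ n ] = fromℤ-⊖ m (suc n)
  fromℤ-+ -[1+ m ] (+ n)    = trans (fromℤ-⊖ n (suc m)) (+-comm _ _)
  fromℤ-+ -[1+ m ] -[1+ n ] = begin
    - (suc (suc (m ℕ.+ n)) ×ᴿ 1#)      ≡⟨ cong (λ k → - (k ×ᴿ 1#)) (ℕ.+-suc (suc m) n) ⟨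
    - ((suc m ℕ.+ suc n) ×ᴿ 1#)        ≈⟨ -‿cong (×-homo-+ 1# (suc m) (suc n)) ⟩
    - (suc m ×ᴿ 1# + suc n ×ᴿ 1#)      ≈⟨ -‿+-comm _ _ ⟨
    - (suc m ×ᴿ 1#) - suc n ×ᴿ 1#      ∎

  fromℤ-*-nonneg : ∀ m j → fromℤ (+ m ℤ.* j) ≈ m ×ᴿ 1# * fromℤ j
  fromℤ-*-nonneg m (+ n) = trans (reflexive (cong fromℤ (≡.sym (ℤ.pos-* m n)))) (×1-homo-* m n)
  fromℤ-*-nonneg m -[1+ n ] = begin
    fromℤ (+ m ℤ.* -[1+ n ])           ≡⟨ cong fromℤ (ℤ.neg-distribʳ-* (+ m) (+ suc n)) ⟨
    fromℤ (ℤ.- (+ m ℤ.* + suc n))      ≈⟨ fromℤ-neg (+ m ℤ.* + suc n) ⟩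
    - fromℤ (+ m ℤ.* + suc n)          ≈⟨ -‿cong (fromℤ-*-nonneg m (+ suc n)) ⟩
    - (m ×ᴿ 1# * suc n ×ᴿ 1#)          ≈⟨ -‿distribʳ-* _ _ ⟩
    m ×ᴿ 1# * - (suc n ×ᴿ 1#)          ∎

  fromℤ-* : ∀ i j → fromℤ (i ℤ.* j) ≈ fromℤ i * fromℤ j
  fromℤ-* (+ m)    j = fromℤ-*-nonneg m j
  fromℤ-* -[1+ m ] j = begin
    fromℤ (-[1+ m ] ℤ.* j)             ≡⟨ cong fromℤ (ℤ.neg-distribˡ-* (+ suc m) j) ⟨
    fromℤ (ℤ.- (+ suc m ℤ.* j))        ≈⟨ fromℤ-neg (+ suc m ℤ.* j) ⟩
    - fromℤ (+ suc m ℤ.* j)            ≈⟨ -‿cong (fromℤ-*-nonneg (suc m) j) ⟩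
    - (suc m ×ᴿ 1# * fromℤ j)          ≈⟨ -‿distribˡ-* _ _ ⟩
    - (suc m ×ᴿ 1#) * fromℤ j          ∎

  fromℤ-homomorphism : ℤ.+-*-rawRing -Raw-AlmostCommutative⟶ fromCommutativeRing R
  fromℤ-homomorphism = record
    { ⟦_⟧    = fromℤ
    ; +-homo = fromℤ-+
    ; *-homo = fromℤ-*
    ; -‿homo = fromℤ-neg
    ; 0-homo = R.refl
    ; 1-homo = R.refl
    }

  -- Distinct integers may coincide in `R`, so a failed comparison gives no refutation.
  fromℤ-≟ : ∀ i j → Maybe (fromℤ i ≈ fromℤ j)
  fromℤ-≟ i j = Maybe.map (reflexive ∘ cong fromℤ) (dec⇒maybe (i ℤ.≟ j))

  open import Algebra.Solver.Ring _ _ fromℤ-homomorphism fromℤ-≟ public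

module CubeRelations {c ℓ} (R : CommutativeRing c ℓ) where
  open CommutativeRing R hiding (refl; zero)
  private module R = CommutativeRing R
  open CubeMatrices R
  open IntegerCoefficients R using (solve; _:+_; _:*_; _:-_; :-_; _:=_; con; Polynomial)
  open import Relation.Binary.Reasoning.Setoid setoid

  private
    variable
      D : ℕ

  -- Written in the shape to which `fromℕ 4` unfolds, trailing zero included, so that it denotes
  -- `fromℕ 4` by computation.
  :4 : ∀ {n} → Polynomial n
  :4 = con 1ℤ :+ (con 1ℤ :+ (con 1ℤ :+ (con 1ℤ :+ con 0ℤ)))

  -- Sums over the vertices.

  foldr-+-extract : ∀ e xs → foldr _+_ e xs ≈ foldr _+_ 0# xs + e
  foldr-+-extract e []       = sym (+-identityˡ e)
  foldr-+-extract e (x ∷ xs) = trans (+-congˡ (foldr-+-extract e xs)) (sym (+-assoc x _ e))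

  ∑-∷ : (f : X (suc D) → Carrier) → ∑ f ≈ ∑ (f ∘ (zero ∷_)) + ∑ (f ∘ (suc zero ∷_))
  ∑-∷ {D} f = begin
    ∑ f
      ≡⟨ cong (λ vs → sum (map f (map (zero ∷_) V ++ vs))) (List.++-identityʳ (map (suc zero ∷_) V)) ⟩
    sum (map f (map (zero ∷_) V ++ map (suc zero ∷_) V))
      ≡⟨ cong sum (List.map-++ f (map (zero ∷_) V) (map (suc zero ∷_) V)) ⟩
    sum (map f (map (zero ∷_) V) ++ map f (map (suc zero ∷_) V))
      ≡⟨ cong₂ (λ us vs → sum (us ++ vs)) (List.map-∘ V) (List.map-∘ V) ⟨
    sum (map (f ∘ (zero ∷_)) V ++ map (f ∘ (suc zero ∷_)) V)
      ≡⟨ List.foldr-++ _+_ 0# (map (f ∘ (zero ∷_)) V) _ ⟩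
    foldr _+_ (∑ (f ∘ (suc zero ∷_))) (map (f ∘ (zero ∷_)) V)
      ≈⟨ foldr-+-extract _ (map (f ∘ (zero ∷_)) V) ⟩
    ∑ (f ∘ (zero ∷_)) + ∑ (f ∘ (suc zero ∷_)) ∎
    where
    V   = vertices D
    sum = foldr _+_ 0#

  -- Splitting relative to a bit `a` spares the later inductions a case distinction on the head of a
  -- vertex.
  ∑-opposite : ∀ a (f : X (suc D) → Carrier) → ∑ f ≈ ∑ (f ∘ (a ∷_)) + ∑ (f ∘ (opposite a ∷_))
  ∑-opposite zero       f = ∑-∷ f
  ∑-opposite (suc zero) f = trans (∑-∷ f) (+-comm _ _)

  ∑-cong : {f g : X D → Carrier} → (∀ w → f w ≈ g w) → ∑ f ≈ ∑ g
  ∑-cong {zero}  h = +-congʳ (h [])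
  ∑-cong {suc D} {f} {g} h = begin
    ∑ f
      ≈⟨ ∑-∷ f ⟩
    ∑ (f ∘ (zero ∷_)) + ∑ (f ∘ (suc zero ∷_))
      ≈⟨ +-cong (∑-cong (h ∘ (zero ∷_))) (∑-cong (h ∘ (suc zero ∷_))) ⟩
    ∑ (g ∘ (zero ∷_)) + ∑ (g ∘ (suc zero ∷_))
      ≈⟨ ∑-∷ g ⟨
    ∑ g ∎

  -- Serves both to pull out a scalar (`l` zero) and to merge a difference of sums (coefficients 1
  -- and -1).
  ∑-linear : ∀ k l (f g : X D → Carrier) → ∑ (λ w → k * f w + l * g w) ≈ k * ∑ f + l * ∑ g
  ∑-linear {zero} k l f g =
    solve 4 (λ k l p q → (k :* p :+ l :* q) :+ con 0ℤ := k :* (p :+ con 0ℤ) :+ l :* (q :+ con 0ℤ))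
      R.refl k l (f []) (g [])
  ∑-linear {suc D} k l f g = begin
    ∑ (λ w → k * f w + l * g w)
      ≈⟨ ∑-∷ (λ w → k * f w + l * g w) ⟩
    ∑ (λ w → k * f (zero ∷ w) + l * g (zero ∷ w)) + ∑ (λ w → k * f (suc zero ∷ w) + l * g (suc zero ∷ w))
      ≈⟨ +-cong (∑-linear k l (f ∘ (zero ∷_)) (g ∘ (zero ∷_)))
                 (∑-linear k l (f ∘ (suc zero ∷_)) (g ∘ (suc zero ∷_))) ⟩
    (k * f₀ + l * g₀) + (k * f₁ + l * g₁)
      ≈⟨ solve 6 (λ k l p q r s → (k :* p :+ l :* r) :+ (k :* q :+ l :* s) := k :* (p :+ q) :+ l :* (r :+ s))
           R.refl k l f₀ f₁ g₀ g₁ ⟩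
    k * (f₀ + f₁) + l * (g₀ + g₁)
      ≈⟨ +-cong (*-congˡ (∑-∷ f)) (*-congˡ (∑-∷ g)) ⟨
    k * ∑ f + l * ∑ g ∎
    where
    f₀ = ∑ (f ∘ (zero ∷_))
    f₁ = ∑ (f ∘ (suc zero ∷_))
    g₀ = ∑ (g ∘ (zero ∷_))
    g₁ = ∑ (g ∘ (suc zero ∷_))

  ∑-*ˡ : ∀ k (f : X D → Carrier) → ∑ (λ w → k * f w) ≈ k * ∑ f
  ∑-*ˡ k f = begin
    ∑ (λ w → k * f w)
      ≈⟨ ∑-cong (λ w → solve 2 (λ k p → k :* p := k :* p :+ con 0ℤ :* p) R.refl k (f w)) ⟩
    ∑ (λ w → k * f w + 0# * f w)
      ≈⟨ ∑-linear k 0# f f ⟩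
    k * ∑ f + 0# * ∑ f
      ≈⟨ solve 2 (λ k p → k :* p :+ con 0ℤ :* p := k :* p) R.refl k (∑ f) ⟩
    k * ∑ f ∎

  ∑-zero : ∀ D → ∑ {D} (λ _ → 0#) ≈ 0#
  ∑-zero zero    = +-identityˡ 0#
  ∑-zero (suc D) = trans (∑-∷ {D} (λ _ → 0#)) (trans (+-cong (∑-zero D) (∑-zero D)) (+-identityˡ 0#))

  -- Matrix entries after splitting off the first coordinate.

  identityMatrix : ∀ D → Mat D
  identityMatrix D y z = if does (y ≟ z) then 1# else 0#

  module _ {D : ℕ} where
    I A A* : Mat D
    I  = identityMatrix D
    A  = adjacencyMatrix D
    A* = dualAdjacencyMatrix D

    θ : X D → Carrier
    θ y = fromℕ D - fromℕ (2 ℕ.* ∂ (origin D) y)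

  -- Vector equality is decided head first, so the entry computes once the head is concrete.
  I-∷ : ∀ a (y z : X D) → I (a ∷ y) (a ∷ z) ≡ I y z
  I-∷ zero       y z = refl
  I-∷ (suc zero) y z = refl

  I-opposite : ∀ a (y z : X D) → I (a ∷ y) (opposite a ∷ z) ≡ 0#
  I-opposite zero       y z = refl
  I-opposite (suc zero) y z = refl

  opposite-≢ : (a : Fin 2) → a ≢ opposite a
  opposite-≢ zero       ()
  opposite-≢ (suc zero) ()

  -- `adjacent?` searches all coordinates and does not reduce to the tails, but decisions of
  -- equivalent propositions have equal booleans.
  A-∷ : ∀ a (y z : X D) → A (a ∷ y) (a ∷ z) ≡ A y z
  A-∷ a y z = cong (λ b → if b then 1# else 0#)
    (does-⇔ (mk⇔ to from) (adjacent? (a ∷ y) (a ∷ z)) (adjacent? y z))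
    where
    to : Adjacent (a ∷ y) (a ∷ z) → Adjacent y z
    to e@(i , d , u) with split e
    -- Equal heads and equal tails leave no coordinate for `d` to separate.
    ... | inj₁ refl    = contradiction refl d
    ... | inj₂ (_ , f) = f
    from : Adjacent y z → Adjacent (a ∷ y) (a ∷ z)
    from (i , d , u) = suc i , d , λ
      { {zero}  e → contradiction refl e
      ; {suc j} e → cong suc (u e) }

  -- The heads use up the one coordinate in which adjacent vertices differ.
  A-flip : ∀ {a b} → a ≢ b → (y z : X D) → A (a ∷ y) (b ∷ z) ≡ I y z
  A-flip {a = a} {b} a≢b y z = cong (λ b → if b then 1# else 0#)
    (does-⇔ (mk⇔ to (λ { refl → flip y a≢b })) (adjacent? (a ∷ y) (b ∷ z)) (y ≟ z))
    where
    to : Adjacent (a ∷ y) (b ∷ z) → y ≡ z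
    to e with split e
    ... | inj₁ y≡z       = y≡z
    ... | inj₂ (a≡b , _) = contradiction a≡b a≢b

  sign : Fin 2 → Carrier
  sign zero       = 1#
  sign (suc zero) = - 1#

  sign-opposite : ∀ a → sign (opposite a) ≈ - sign a
  sign-opposite zero       = R.refl
  sign-opposite (suc zero) = solve 0 (con 1ℤ := :- (:- con 1ℤ)) R.refl

  sign² : ∀ a → sign a * sign a ≈ 1#
  sign² zero       = *-identityˡ 1#
  sign² (suc zero) = solve 0 ((:- con 1ℤ) :* (:- con 1ℤ) := con 1ℤ) R.refl

  -- A head 0 raises D by one and keeps the distance; a head 1 also raises the distance by one, for
  -- a net change of 1 - 2.
  θ-∷ : ∀ a (y : X D) → θ (a ∷ y) ≈ sign a + θ y
  θ-∷ zero y = +-assoc _ _ _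
  θ-∷ {D} (suc zero) y = begin
    -- `∂` computes to the Hamming distance, so the head 1 already appears as `suc`.
    fromℕ (suc D) - fromℕ (2 ℕ.* suc n)
      ≡⟨ cong (λ m → fromℕ (suc D) - fromℕ m) (ℕ.*-suc 2 n) ⟩
    (1# + fromℕ D) - (1# + (1# + fromℕ (2 ℕ.* n)))
      ≈⟨ solve 2 (λ d e → (con 1ℤ :+ d) :- (con 1ℤ :+ (con 1ℤ :+ e)) := (:- con 1ℤ) :+ (d :- e))
           R.refl (fromℕ D) (fromℕ (2 ℕ.* n)) ⟩
    - 1# + θ y ∎
    where n = ∂ (origin D) y

  θ-opposite : ∀ a (y : X D) → θ (opposite a ∷ y) ≈ - sign a + θ y
  θ-opposite a y = trans (θ-∷ (opposite a) y) (+-congʳ (sign-opposite a))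

  -- Sums against the identity and products with `A*`.

  I-subst : (f : X D → Carrier) → ∀ y z → I y z * f z ≈ I y z * f y
  I-subst f y z with y ≟ z
  ... | yes refl = R.refl
  ... | no _     = trans (zeroˡ _) (sym (zeroˡ _))

  -- Only the half of the cube that shares the head of `y` contributes.
  ∑-I : ∀ y (f : X D → Carrier) → ∑ (λ w → I y w * f w) ≈ f y
  ∑-I {zero} [] f = trans (+-identityʳ _) (*-identityˡ _)
  ∑-I {suc D} (a ∷ y) f = begin
    ∑ (λ w → I (a ∷ y) w * f w)
      ≈⟨ ∑-opposite a (λ w → I (a ∷ y) w * f w) ⟩
    ∑ (λ w → I (a ∷ y) (a ∷ w) * f (a ∷ w)) + ∑ (λ w → I (a ∷ y) (opposite a ∷ w) * f (opposite a ∷ w))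
      ≈⟨ +-cong (∑-cong λ w → *-congʳ (reflexive (I-∷ a y w)))
                (∑-cong λ w → trans (*-congʳ (reflexive (I-opposite a y w))) (zeroˡ _)) ⟩
    ∑ (λ w → I y w * f (a ∷ w)) + ∑ {D} (λ _ → 0#)
      ≈⟨ +-cong (∑-I y (f ∘ (a ∷_))) (∑-zero D) ⟩
    f (a ∷ y) + 0#
      ≈⟨ +-identityʳ _ ⟩
    f (a ∷ y) ∎

  I-sym : (y z : X D) → I y z ≡ I z y
  I-sym y z = cong (λ b → if b then 1# else 0#) (does-⇔ (mk⇔ ≡.sym ≡.sym) (y ≟ z) (z ≟ y))

  ∑-Iʳ : ∀ z (f : X D → Carrier) → ∑ (λ w → f w * I w z) ≈ f z
  ∑-Iʳ z f = trans (∑-cong λ w → trans (*-comm _ _) (*-congʳ (reflexive (I-sym w z)))) (∑-I z f)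

  A*-entry : (y z : X D) → A* y z ≈ I y z * θ y
  A*-entry y z with does (y ≟ z)
  ... | true  = sym (*-identityˡ _)
  ... | false = sym (zeroˡ _)

  -- `A*` is diagonal, so `∑-I` collapses the product to a scaling of rows.
  A*⊗-entry : ∀ M (y z : X D) → (A* ⊗ M) y z ≈ θ y * M y z
  A*⊗-entry M y z = begin
    ∑ (λ w → A* y w * M w z)         ≈⟨ ∑-cong (λ w → trans (*-congʳ (A*-entry y w)) (*-assoc _ _ _)) ⟩
    ∑ (λ w → I y w * (θ y * M w z))  ≈⟨ ∑-I y (λ w → θ y * M w z) ⟩
    θ y * M y z                      ∎

  ⊗A*-entry : ∀ M (y z : X D) → (M ⊗ A*) y z ≈ M y z * θ z
  ⊗A*-entry M y z = begin
    ∑ (λ w → M y w * A* w z)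
      ≈⟨ ∑-cong (λ w → trans (*-congˡ (trans (A*-entry w z) (*-comm _ _))) (sym (*-assoc _ _ _))) ⟩
    ∑ (λ w → M y w * θ w * I w z)
      ≈⟨ ∑-Iʳ z (λ w → M y w * θ w) ⟩
    M y z * θ z ∎

  -- Matching on this view turns the second head into `a` or `opposite a`, the forms in which the
  -- splitting lemmas are stated.
  data Head (a : Fin 2) : Fin 2 → Set where
    same  : Head a a
    other : Head a (opposite a)

  head : ∀ a b → Head a b
  head zero       zero       = same
  head zero       (suc zero) = other
  head (suc zero) zero       = other
  head (suc zero) (suc zero) = same

  -- The two identities proved by induction on D.

  -- Equal heads add the same sign to both values, which cancels. Opposite heads turn `A` into `I`,
  -- so the tails may be identified; the difference is then 2 `sign a`, with square 4.
  A-*-θ-difference² : (y z : X D) → A y z * ((θ y - θ z) * (θ y - θ z)) ≈ fromℕ 4 * A y z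
  A-*-θ-difference² {zero} [] [] =
    -- The 0-cube has no edges, so its `A` entry computes to `0#`.
    solve 2 (λ t u → con 0ℤ :* t := u :* con 0ℤ) R.refl _ (fromℕ 4)
  A-*-θ-difference² {suc D} (a ∷ y) (b ∷ z) with head a b
  ... | same = begin
    A (a ∷ y) (a ∷ z) * ((θ (a ∷ y) - θ (a ∷ z)) * (θ (a ∷ y) - θ (a ∷ z)))
      ≈⟨ *-cong (reflexive (A-∷ a y z)) (*-cong difference difference) ⟩
    A y z * ((θ y - θ z) * (θ y - θ z))
      ≈⟨ A-*-θ-difference² y z ⟩
    fromℕ 4 * A y z
      ≡⟨ cong (fromℕ 4 *_) (A-∷ a y z) ⟨
    fromℕ 4 * A (a ∷ y) (a ∷ z) ∎
    where
    difference : θ (a ∷ y) - θ (a ∷ z) ≈ θ y - θ z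
    difference = trans (+-cong (θ-∷ a y) (-‿cong (θ-∷ a z)))
      (solve 3 (λ s p q → (s :+ p) :- (s :+ q) := p :- q) R.refl (sign a) (θ y) (θ z))
  ... | other = begin
    A (a ∷ y) (opposite a ∷ z) * (d * d)
      ≡⟨ cong (_* (d * d)) (A-flip (opposite-≢ a) y z) ⟩
    I y z * (d * d)
      ≈⟨ *-congˡ (*-cong difference difference) ⟩
    I y z * square z
      ≈⟨ I-subst square y z ⟩
    I y z * square y
      ≈⟨ solve 3 (λ i s p → i :* (((s :+ p) :- ((:- s) :+ p)) :* ((s :+ p) :- ((:- s) :+ p)))
                          := :4 :* (i :* (s :* s))) R.refl (I y z) (sign a) (θ y) ⟩
    fromℕ 4 * (I y z * (sign a * sign a))
      ≈⟨ *-congˡ (trans (*-congˡ (sign² a)) (*-identityʳ _)) ⟩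
    fromℕ 4 * I y z
      ≡⟨ cong (fromℕ 4 *_) (A-flip (opposite-≢ a) y z) ⟨
    fromℕ 4 * A (a ∷ y) (opposite a ∷ z) ∎
    where
    d = θ (a ∷ y) - θ (opposite a ∷ z)
    e = λ x → (sign a + θ y) - (- sign a + θ x)
    square = λ x → e x * e x
    difference : d ≈ e z
    difference = +-cong (θ-∷ a y) (-‿cong (θ-opposite a z))

  -- At θ-values of a path y, w, z this is (θ w - θ y) - (θ z - θ w), the factor left when the
  -- w-terms of EA and AE are subtracted.
  excess : (p q r : Carrier) → Carrier
  excess p q r = (q - p) + (q - r)

  excess-cong : ∀ {p p′ q q′ r r′} → p ≈ p′ → q ≈ q′ → r ≈ r′ → excess p q r ≈ excess p′ q′ r′
  excess-cong p q r = +-cong (+-cong q (-‿cong p)) (+-cong q (-‿cong r))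

  :excess : ∀ {n} (p q r : Polynomial n) → Polynomial n
  :excess p q r = (q :- p) :+ (q :- r)

  -- For equal heads, paths keeping the head give the inductive sum, since the signs cancel; a path
  -- that flips the head and flips it back has y, w and z with the same tail and adds -4 `sign a`.
  -- For opposite heads, the two orders of flipping the head and moving in the tail have opposite
  -- excesses.
  ∑-A-A-excess : (y z : X D) →
    ∑ (λ w → A y w * A w z * excess (θ y) (θ w) (θ z)) ≈ - fromℕ 4 * (I y z * θ y)
  ∑-A-A-excess {zero} [] [] =
    solve 2 (λ t u → con 0ℤ :* con 0ℤ :* t :+ con 0ℤ := u :* (con 1ℤ :* (con 0ℤ :- con 0ℤ)))
      R.refl _ (- fromℕ 4)
  ∑-A-A-excess {suc D} (a ∷ y) (b ∷ z) with head a b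
  ... | same = begin
    ∑ f
      ≈⟨ ∑-opposite a f ⟩
    ∑ (f ∘ (a ∷_)) + ∑ (f ∘ (opposite a ∷_))
      ≈⟨ +-cong (∑-cong keep) (∑-cong move) ⟩
    ∑ (λ w → A y w * A w z * excess (θ y) (θ w) (θ z)) + ∑ (λ w → I y w * (I w z * e w z))
      ≈⟨ +-cong (∑-A-A-excess y z) (∑-I y (λ w → I w z * e w z)) ⟩
    - fromℕ 4 * (I y z * θ y) + I y z * e y z
      ≈⟨ +-congˡ (I-subst (e y) y z) ⟩
    - fromℕ 4 * (I y z * θ y) + I y z * e y y
      ≈⟨ solve 3 (λ i s p → (:- :4) :* (i :* p) :+ i :* :excess (s :+ p) ((:- s) :+ p) (s :+ p)
                          := (:- :4) :* (i :* (s :+ p))) R.refl (I y z) (sign a) (θ y) ⟩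
    - fromℕ 4 * (I y z * (sign a + θ y))
      ≈⟨ *-congˡ (*-cong (reflexive (I-∷ a y z)) (θ-∷ a y)) ⟨
    - fromℕ 4 * (I (a ∷ y) (a ∷ z) * θ (a ∷ y)) ∎
    where
    f : X (suc D) → Carrier
    f w = A (a ∷ y) w * A w (a ∷ z) * excess (θ (a ∷ y)) (θ w) (θ (a ∷ z))
    e : X D → X D → Carrier
    e w x = excess (sign a + θ y) (- sign a + θ w) (sign a + θ x)
    keep : ∀ w → f (a ∷ w) ≈ A y w * A w z * excess (θ y) (θ w) (θ z)
    keep w = *-cong (*-cong (reflexive (A-∷ a y w)) (reflexive (A-∷ a w z)))
      (trans (excess-cong (θ-∷ a y) (θ-∷ a w) (θ-∷ a z))
        (solve 4 (λ s p q r → :excess (s :+ p) (s :+ q) (s :+ r) := :excess p q r)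
          R.refl (sign a) (θ y) (θ w) (θ z)))
    move : ∀ w → f (opposite a ∷ w) ≈ I y w * (I w z * e w z)
    move w = trans
      (*-cong (*-cong (reflexive (A-flip (opposite-≢ a) y w))
                      (reflexive (A-flip (opposite-≢ a ∘ ≡.sym) w z)))
              (excess-cong (θ-∷ a y) (θ-opposite a w) (θ-∷ a z)))
      (*-assoc _ _ _)
  ... | other = begin
    ∑ f
      ≈⟨ ∑-opposite a f ⟩
    ∑ (f ∘ (a ∷_)) + ∑ (f ∘ (opposite a ∷_))
      -- A middle vertex with head `a` flips it in the second step and has tail `z`; one with the
      -- opposite head flipped it in the first step and has tail `y`.
      ≈⟨ +-cong (∑-cong moveʳ) (∑-cong moveˡ) ⟩
    ∑ (λ w → A y w * excess (s + θ y) (s + θ w) (- s + θ z) * I w z)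
      + ∑ (λ w → I y w * (A w z * excess (s + θ y) (- s + θ w) (- s + θ z)))
      ≈⟨ +-cong (∑-Iʳ z _) (∑-I y _) ⟩
    A y z * excess (s + θ y) (s + θ z) (- s + θ z) + A y z * excess (s + θ y) (- s + θ y) (- s + θ z)
      -- The excesses are θ z - θ y + 2s and θ y - θ z - 2s. Their zero sum is written in the shape
      -- of the goal, whose `I` entry is `0#`.
      ≈⟨ solve 4 (λ m s p r → m :* :excess (s :+ p) (s :+ r) ((:- s) :+ r)
                              :+ m :* :excess (s :+ p) ((:- s) :+ p) ((:- s) :+ r)
                            := (:- :4) :* (con 0ℤ :* p)) R.refl (A y z) s (θ y) (θ z) ⟩
    - fromℕ 4 * (0# * θ y)
      ≈⟨ *-congˡ (trans (zeroˡ _) (sym (zeroˡ _))) ⟩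
    - fromℕ 4 * (0# * θ (a ∷ y))
      ≡⟨ cong (λ i → - fromℕ 4 * (i * θ (a ∷ y))) (I-opposite a y z) ⟨
    - fromℕ 4 * (I (a ∷ y) (opposite a ∷ z) * θ (a ∷ y)) ∎
    where
    s = sign a
    f : X (suc D) → Carrier
    f w = A (a ∷ y) w * A w (opposite a ∷ z) * excess (θ (a ∷ y)) (θ w) (θ (opposite a ∷ z))
    moveʳ : ∀ w → f (a ∷ w) ≈ A y w * excess (s + θ y) (s + θ w) (- s + θ z) * I w z
    moveʳ w = trans
      (*-cong (*-cong (reflexive (A-∷ a y w)) (reflexive (A-flip (opposite-≢ a) w z)))
              (excess-cong (θ-∷ a y) (θ-∷ a w) (θ-opposite a z)))
      (solve 3 (λ m i t → m :* i :* t := m :* t :* i) R.refl _ _ _)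
    moveˡ : ∀ w → f (opposite a ∷ w) ≈ I y w * (A w z * excess (s + θ y) (- s + θ w) (- s + θ z))
    moveˡ w = trans
      (*-cong (*-cong (reflexive (A-flip (opposite-≢ a) y w)) (reflexive (A-∷ (opposite a) w z)))
              (excess-cong (θ-∷ a y) (θ-opposite a w) (θ-opposite a z)))
      (*-assoc _ _ _)

  -- The three commutator relations over a commutative ring.

  commutator-entry : (y z : X D) → (A ⊗ A* ⊖ A* ⊗ A) y z ≈ A y z * (θ z - θ y)
  commutator-entry y z = trans
    (+-cong (⊗A*-entry A y z) (-‿cong (A*⊗-entry A y z)))
    (solve 3 (λ m p r → m :* r :- p :* m := m :* (r :- p)) R.refl (A y z) (θ y) (θ z))

  scaledCommutator : Carrier → Mat D → Mat D → Mat D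
  scaledCommutator k M N = k • (M ⊗ N ⊖ N ⊗ M)

  -- `h` and `k` abstract 2i and -i/2; the hypotheses imply h² = -4. Keeping `four` apart from
  -- `fromℕ 4` permits a single rational constant over the complex numbers.
  module _ {h k four : Carrier} (four≈4 : four ≈ fromℕ 4) (hk≈1 : h * k ≈ 1#) (k4≈-h : k * four ≈ - h) where

    E : Mat D
    E = scaledCommutator k A A*

    E-entry : (y z : X D) → E y z ≈ k * (A y z * (θ z - θ y))
    E-entry y z = *-congˡ (commutator-entry y z)

    k*fromℕ4≈-h : k * fromℕ 4 ≈ - h
    k*fromℕ4≈-h = trans (*-congˡ (sym four≈4)) k4≈-h

    [A,A*]≋hE : A {D} ⊗ A* ⊖ A* ⊗ A ≋ h • E
    [A,A*]≋hE y z = sym (trans (sym (*-assoc _ _ _)) (trans (*-congʳ hk≈1) (*-identityˡ _)))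

    -- Two commutators with a diagonal matrix multiply each entry of `A` by a squared difference of
    -- θ-values, up to sign, and -4k = h.
    [A*,E]≋hA : A* {D} ⊗ E ⊖ E ⊗ A* ≋ h • A
    [A*,E]≋hA y z = begin
      (A* ⊗ E) y z - (E ⊗ A*) y z
        ≈⟨ +-cong (A*⊗-entry E y z) (-‿cong (⊗A*-entry E y z)) ⟩
      θ y * E y z - E y z * θ z
        ≈⟨ +-cong (*-congˡ (E-entry y z)) (-‿cong (*-congʳ (E-entry y z))) ⟩
      θ y * (k * (A y z * (θ z - θ y))) - k * (A y z * (θ z - θ y)) * θ z
        ≈⟨ solve 4 (λ k m p r → p :* (k :* (m :* (r :- p))) :- k :* (m :* (r :- p)) :* r
                             := :- (k :* (m :* ((p :- r) :* (p :- r))))) R.refl k (A y z) (θ y) (θ z) ⟩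
      - (k * (A y z * ((θ y - θ z) * (θ y - θ z))))
        ≈⟨ -‿cong (*-congˡ (A-*-θ-difference² y z)) ⟩
      - (k * (fromℕ 4 * A y z))
        ≈⟨ -‿cong (trans (sym (*-assoc _ _ _)) (*-congʳ k*fromℕ4≈-h)) ⟩
      - (- h * A y z)
        ≈⟨ solve 2 (λ h m → :- ((:- h) :* m) := h :* m) R.refl h (A y z) ⟩
      h * A y z ∎

    [E,A]≋hA* : E {D} ⊗ A ⊖ A ⊗ E ≋ h • A*
    [E,A]≋hA* y z = begin
      ∑ (λ w → E y w * A w z) - ∑ (λ w → A y w * E w z)
        -- Coefficients 1 and -1 let `∑-linear` merge both products into one sum over the middle
        -- vertex.
        ≈⟨ solve 2 (λ p q → p :- q := con 1ℤ :* p :+ (:- con 1ℤ) :* q) R.refl _ _ ⟩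
      1# * ∑ (λ w → E y w * A w z) + - 1# * ∑ (λ w → A y w * E w z)
        ≈⟨ ∑-linear 1# (- 1#) (λ w → E y w * A w z) (λ w → A y w * E w z) ⟨
      ∑ (λ w → 1# * (E y w * A w z) + - 1# * (A y w * E w z))
        ≈⟨ ∑-cong (λ w → trans
             (+-cong (*-congˡ (*-congʳ (E-entry y w))) (*-congˡ (*-congˡ (E-entry w z))))
             (solve 6 (λ k m n p q r →
                 con 1ℤ :* (k :* (m :* (q :- p)) :* n) :+ (:- con 1ℤ) :* (m :* (k :* (n :* (r :- q))))
                   := k :* (m :* n :* :excess p q r))
               R.refl k (A y w) (A w z) (θ y) (θ w) (θ z))) ⟩
      ∑ (λ w → k * (A y w * A w z * excess (θ y) (θ w) (θ z)))
        ≈⟨ ∑-*ˡ k (λ w → A y w * A w z * excess (θ y) (θ w) (θ z)) ⟩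
      k * ∑ (λ w → A y w * A w z * excess (θ y) (θ w) (θ z))
        ≈⟨ *-congˡ (∑-A-A-excess y z) ⟩
      k * (- fromℕ 4 * (I y z * θ y))
        ≈⟨ solve 3 (λ k f t → k :* ((:- f) :* t) := :- (k :* f) :* t) R.refl k (fromℕ 4) _ ⟩
      - (k * fromℕ 4) * (I y z * θ y)
        ≈⟨ *-cong (trans (-‿cong k*fromℕ4≈-h) (solve 1 (λ h → :- (:- h) := h) R.refl h)) (sym (A*-entry y z)) ⟩
      h * A* y z ∎

    -- Over ℂ, comparing compound expressions that reach the matrix operations through different
    -- module instantiations unfolds nested sums of complex numbers and is infeasible. With the
    -- operations as variables, unification finds them and they are compared one at a time.
    relations : {_⊗′_ _⊖′_ : Mat D → Mat D → Mat D} {_•′_ : Carrier → Mat D → Mat D} {A′ A*′ E′ : Mat D} →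
      _⊗′_ ≡ _⊗_ → _⊖′_ ≡ _⊖_ → _•′_ ≡ _•_ → A′ ≡ A → A*′ ≡ A* → E′ ≡ scaledCommutator k A′ A*′ →
        (∀ y z → ((A′ ⊗′ A*′) ⊖′ (A*′ ⊗′ A′)) y z ≈ (h •′ E′) y z)
      × (∀ y z → ((A*′ ⊗′ E′) ⊖′ (E′ ⊗′ A*′)) y z ≈ (h •′ A′) y z)
      × (∀ y z → ((E′ ⊗′ A′) ⊖′ (A′ ⊗′ E′)) y z ≈ (h •′ A*′) y z)
    relations refl refl refl refl refl refl = [A,A*]≋hE , [A*,E]≋hA , [E,A]≋hA*

-- Specialisation to the complex numbers.

open import Defs

lemma6p3 : (D : ℕ) → .{{_ : NonZero D}} →
    (A D ⊗ A* D ⊖ A* D ⊗ A D ≋ 2𝐢 • Aᵋ D)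
    × (A* D ⊗ Aᵋ D ⊖ Aᵋ D ⊗ A* D ≋ 2𝐢 • A D)
    × (Aᵋ D ⊗ A D ⊖ A D ⊗ Aᵋ D ≋ 2𝐢 • A* D)
lemma6p3 D = CubeRelations.relations ℂ {2𝐢} { -ᶜ 𝐢 *ᶜ fromℚ ½} four≈4 hk≈1 k4≈-h ⊗≡ ⊖≡ •≡ A≡ A*≡ Aᵋ≡
  where
  module C = CubeMatrices
  -- In these three equations all components are constant sequences of explicit rationals, so
  -- equality at each index is a closed computation.
  four≈4 : fromℚ (+ 4 / 1) ≈ᶜ fromℕ 4
  four≈4 = pointwise⇒≈ℝ {re (fromℚ (+ 4 / 1))} {re (fromℕ 4)} (λ _ → refl)
         , pointwise⇒≈ℝ {im (fromℚ (+ 4 / 1))} {im (fromℕ 4)} (λ _ → refl)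
  hk≈1 : 2𝐢 *ᶜ (-ᶜ 𝐢 *ᶜ fromℚ ½) ≈ᶜ fromℚ 1ℚ
  hk≈1 = pointwise⇒≈ℝ {re (2𝐢 *ᶜ (-ᶜ 𝐢 *ᶜ fromℚ ½))} {constℝ 1ℚ} (λ _ → refl)
       , pointwise⇒≈ℝ {im (2𝐢 *ᶜ (-ᶜ 𝐢 *ᶜ fromℚ ½))} {constℝ 0ℚ} (λ _ → refl)
  k4≈-h : (-ᶜ 𝐢 *ᶜ fromℚ ½) *ᶜ fromℚ (+ 4 / 1) ≈ᶜ -ᶜ 2𝐢
  k4≈-h = pointwise⇒≈ℝ {re ((-ᶜ 𝐢 *ᶜ fromℚ ½) *ᶜ fromℚ (+ 4 / 1))} {re (-ᶜ 2𝐢)} (λ _ → refl)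
        , pointwise⇒≈ℝ {im ((-ᶜ 𝐢 *ᶜ fromℚ ½) *ᶜ fromℚ (+ 4 / 1))} {im (-ᶜ 2𝐢)} (λ _ → refl)
  ⊗≡ : _⊗_ {D} ≡ C._⊗_ ℂ
  ⊗≡ = refl
  ⊖≡ : _⊖_ {D} ≡ C._⊖_ ℂ
  ⊖≡ = refl
  •≡ : _•_ {D} ≡ C._•_ ℂ
  •≡ = refl
  A≡ : A D ≡ C.adjacencyMatrix ℂ D
  A≡ = refl
  A*≡ : A* D ≡ C.dualAdjacencyMatrix ℂ D
  A*≡ = refl
  Aᵋ≡ : Aᵋ D ≡ CubeRelations.scaledCommutator ℂ (-ᶜ 𝐢 *ᶜ fromℚ ½) (A D) (A* D)
  Aᵋ≡ = refl
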